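{- Let $X$ be a finite nonempty set and let $U,V\in\operatorname{Bip}(X)$. Then $V$ covers $U$ in $\operatorname{Bip}(X)$ if and only if the ordered bipartition representation of $V$ may be obtained from the ordered bipartition representation of $U$ in one of the following three ways: (i) join two adjacent underlined blocks of $U$ (into one underlined block); (ii) separate a nonunderlined block of $U$ into two adjacent (nonempty) nonunderlined blocks; or (iii) change a nonunderlined singleton block of $U$ into an underlined singleton block. Moreover, $\operatorname{Bip}(X)$ is a graded poset, with rank function $$\operatorname{rk}\bigl(U(B_1^{\varepsilon_1},B_2^{\varepsilon_2},\ldots,B_k^{\varepsilon_k})\bigr)=3\cdot\sum_{i:\varepsilon_i=1}|B_i|+\bigl|\{i:\varepsilon_i=0\}\bigr|-\bigl|\{i:\varepsilon_i=1\}\bigr|-1.$$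
   Context: A relation $U\subseteq X\times X$ on a finite set $X$ is bipartitional if both $U$ and $(X\times X)\setminus U$ are transitive. $\operatorname{Bip}(X)$ is the set of bipartitional relations on $X$, partially ordered by inclusion. An ordered partition of $X$ is an ordered list $(B_1,\ldots,B_k)$ of pairwise disjoint nonempty subsets (blocks) with union $X$. Every bipartitional relation $U$ on $X$ is represented by a unique pair consisting of an ordered partition $(B_1,\ldots,B_k)$ of $X$ and a vector $(\varepsilon_1,\ldots,\varepsilon_k)\in\{0,1\}^k$ via: $(x,y)\in U$ if and only if either $x\in B_i$, $y\in B_j$ for some $i<j$, or $x,y\in B_i$ for some $i$ with $\varepsilon_i=1$. Conversely, every such pair defines a bipartitional relation in this way. One writes $U=U(B_1^{\varepsilon_1},\ldots,B_k^{\varepsilon_k})$ and calls $(B_1^{\varepsilon_1},\ldots,B_k^{\varepsilon_k})$ the ordered bipartition representation of $U$; the block $B_i$ is underlined if $\varepsilon_i=1$ and nonunderlined if $\varepsilon_i=0$. -}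

module Defs where

open import Level using (Level; _⊔_; 0ℓ) renaming (suc to lsuc)
open import Data.Bool.Base using (Bool; true; false)
import Data.Bool.Properties as Bool
open import Data.Fin.Base as Fin using (Fin)
open import Data.Fin.Properties as Fin using (any?)
open import Data.Fin.Subset
  using (Subset; _∈_; _∩_; _∪_; ⁅_⁆; ∣_∣; Nonempty; Empty)
open import Data.Fin.Subset.Properties
  using (x∈p∩q⁻; nonempty?; ∣p∣≤n; p⊆q⇒∣p∣≤∣q∣; p⊂q⇒∣p∣<∣q∣)
open import Data.Integer.Base as ℤ using (ℤ; +_; 0ℤ; 1ℤ)
open import Data.List.Base as List
  using (List; []; _∷_; _++_; length; map; filter; lookup; sum; upTo)
open import Data.List.Membership.Propositional using (lose)
open import Data.List.Membership.Propositional.Properties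
  using (∈-map⁺; ∈-filter⁺; ∈-upTo⁺; ∈-lookup)
open import Data.List.Relation.Unary.All as All using (All; []; _∷_)
import Data.List.Relation.Unary.All.Properties as All
open import Data.List.Relation.Unary.AllPairs as AllPairs using (AllPairs; []; _∷_)
import Data.List.Relation.Unary.AllPairs.Properties as AllPairs
open import Data.List.Relation.Unary.Any as Any using (Any)
import Data.List.Relation.Unary.Any.Properties as Any
open import Data.List.Relation.Unary.Linked using (Linked)
open import Data.Nat.Base as ℕ using (ℕ; suc; s≤s)
import Data.Nat.Properties as ℕ
open import Data.Product.Base using (∃; ∃₂; _×_; _,_; proj₁; proj₂)
open import Data.Sum.Base using (_⊎_; inj₁; inj₂)
import Data.Vec.Base as Vec
import Data.Vec.Properties as Vec
open import Function.Base using (_∘_)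
open import Relation.Binary.Bundles using (Poset)
import Relation.Binary.Core as Rel
open import Relation.Binary.Core using (Rel)
open import Relation.Binary.Definitions
  using (Decidable; Transitive; tri<; tri≈; tri>)
import Relation.Binary.Properties.Poset as PosetProperties
open import Relation.Binary.PropositionalEquality
  using (_≡_; refl; sym; trans; subst)
open import Relation.Nullary
  using (¬_; Dec; yes; no; does; contradiction; ¬?; _×-dec_)
open import Relation.Nullary.Decidable
  using (decidable-stable; dec-true)
import Relation.Unary as Pred

module _ {c ℓ₁ ℓ₂ : Level} (P : Poset c ℓ₁ ℓ₂) where
  open Poset P
  open PosetProperties P using (_<_)

  -- Covers x y : y covers x.
  Covers : Rel Carrier (c ⊔ ℓ₁ ⊔ ℓ₂)
  Covers x y = x < y × (∀ z → ¬ (x < z × z < y))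

  Minimal : Carrier → Set (c ⊔ ℓ₁ ⊔ ℓ₂)
  Minimal x = ∀ y → y ≤ x → y ≈ x

  -- A finite chain, listed in increasing order, is maximal when every
  -- element comparable with all its members already belongs to it.
  record MaximalChain (xs : List Carrier) : Set (c ⊔ ℓ₁ ⊔ ℓ₂) where
    field
      chain   : Linked _<_ xs
      maximal : ∀ y → All (λ x → x ≤ y ⊎ y ≤ x) xs → Any (y ≈_) xs

  -- For posets with finitely many elements, whose chains are all finite.
  Graded : Set (c ⊔ ℓ₁ ⊔ ℓ₂)
  Graded = ∀ xs ys → MaximalChain xs → MaximalChain ys → length xs ≡ length ys

  record IsRankFunction (ρ : Carrier → ℤ) : Set (c ⊔ ℓ₁ ⊔ ℓ₂) where
    field
      ρ-cong    : ∀ {x y} → x ≈ y → ρ x ≡ ρ y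
      ρ-minimal : ∀ {x} → Minimal x → ρ x ≡ 0ℤ
      ρ-covers  : ∀ {x y} → Covers x y → ρ y ≡ ρ x ℤ.+ 1ℤ

-- Relations are subsets of a finite set, hence decidable.
record Bip (n : ℕ) : Set₁ where
  field
    _∼_      : Rel (Fin n) 0ℓ
    _∼?_     : Decidable _∼_
    ∼-trans  : Transitive _∼_
    ≁-trans  : Transitive (λ x y → ¬ (x ∼ y))

Bip-poset : ℕ → Poset (lsuc 0ℓ) 0ℓ 0ℓ
Bip-poset n = record
  { Carrier        = Bip n
  ; _≈_            = λ U V → Bip._∼_ U Rel.⇔ Bip._∼_ V
  ; _≤_            = λ U V → Bip._∼_ U Rel.⇒ Bip._∼_ V
  ; isPartialOrder = record
    { isPreorder = record
      { isEquivalence = record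
        { refl  = (λ p → p) , (λ p → p)
        ; sym   = λ (f , g) → g , f
        ; trans = λ (f , g) (f′ , g′) → (λ p → f′ (f p)) , (λ p → g (g′ p))
        }
      ; reflexive = proj₁
      ; trans     = λ f g p → g (f p)
      }
    ; antisym = _,_
    }
  }

-- B ^ true is an underlined block, B ^ false a nonunderlined one.
infix 5 _^_
record Block (n : ℕ) : Set where
  constructor _^_
  field
    set        : Subset n
    underlined : Bool
open Block public

record IsOrderedBipartition {n : ℕ} (bs : List (Block n)) : Set where
  field
    nonempty : All (Nonempty ∘ set) bs
    disjoint : AllPairs (λ b c → Empty (set b ∩ set c)) bs
    union    : ∀ x → Any (λ b → x ∈ set b) bs

-- The relation U(B₁^ε₁, …, Bₖ^εₖ).
⟦_⟧ : {n : ℕ} → List (Block n) → Rel (Fin n) 0ℓ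
⟦ bs ⟧ x y =
    (∃₂ λ i j → i Fin.< j × x ∈ set (lookup bs i) × y ∈ set (lookup bs j))
  ⊎ (∃ λ i → x ∈ set (lookup bs i) × y ∈ set (lookup bs i)
           × underlined (lookup bs i) ≡ true)

record Represents {n : ℕ} (bs : List (Block n)) (U : Bip n) : Set where
  field
    isOrderedBipartition : IsOrderedBipartition bs
    equivalent           : ⟦ bs ⟧ Rel.⇔ Bip._∼_ U

data Move {n : ℕ} : Rel (List (Block n)) 0ℓ where
  join      : ∀ bs cs B C →
              Move (bs ++ (B ^ true) ∷ (C ^ true) ∷ cs)
                   (bs ++ (B ∪ C ^ true) ∷ cs)
  separate  : ∀ bs cs B C → Nonempty B → Nonempty C → Empty (B ∩ C) →
              Move (bs ++ (B ∪ C ^ false) ∷ cs)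
                   (bs ++ (B ^ false) ∷ (C ^ false) ∷ cs)
  underline : ∀ bs cs x →
              Move (bs ++ (⁅ x ⁆ ^ false) ∷ cs)
                   (bs ++ (⁅ x ⁆ ^ true) ∷ cs)

blocksWith : {n : ℕ} → Bool → List (Block n) → List (Block n)
blocksWith ε = filter (λ b → underlined b Bool.≟ ε)

blocksRank : {n : ℕ} → List (Block n) → ℤ
blocksRank bs =
  + 3 ℤ.* + sum (map (∣_∣ ∘ set) (blocksWith true bs))
  ℤ.+ + length (blocksWith false bs)
  ℤ.- + length (blocksWith true bs)
  ℤ.- 1ℤ

private
  subset : ∀ {n} {P : Pred.Pred (Fin n) 0ℓ} → Pred.Decidable P → Subset n
  subset P? = Vec.tabulate (does ∘ P?)

  ∈-subset⁺ : ∀ {n} {P : Pred.Pred (Fin n) 0ℓ} (P? : Pred.Decidable P) {x} →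
              P x → x ∈ subset P?
  ∈-subset⁺ P? {x} px = Vec.lookup⇒[]= x _
    (trans (Vec.lookup∘tabulate _ x) (dec-true (P? x) px))

  ∈-subset⁻ : ∀ {n} {P : Pred.Pred (Fin n) 0ℓ} (P? : Pred.Decidable P) {x} →
              x ∈ subset P? → P x
  ∈-subset⁻ P? {x} x∈ with P? x
    | trans (sym (Vec.lookup∘tabulate (does ∘ P?) x)) (Vec.[]=⇒lookup x∈)
  ... | yes px | _  = px
  ... | no  _  | ()

  AllPairs-lookup : ∀ {a ℓ} {A : Set a} {R : Rel A ℓ} {xs : List A} →
                    AllPairs R xs → ∀ {i j} → i Fin.< j →
                    R (lookup xs i) (lookup xs j)
  AllPairs-lookup (px ∷ _)  {Fin.zero}  {Fin.suc j} _         = All.lookup px (∈-lookup j)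
  AllPairs-lookup (_  ∷ ps) {Fin.suc i} {Fin.suc j} (s≤s i<j) = AllPairs-lookup ps i<j

-- The ordered bipartition representation of U.  The blocks are the
-- nonempty level sets of
--   height y = ∣{ x : (x,y) ∈ U, (y,x) ∉ U }∣,
-- in increasing order of height; a block is underlined when U relates one of its
-- elements to itself.
module _ {n : ℕ} (U : Bip n) where
  open Bip U

  private
    _≺_ : Rel (Fin n) 0ℓ
    x ≺ y = x ∼ y × ¬ (y ∼ x)

    _≺?_ : Decidable _≺_
    x ≺? y = (x ∼? y) ×-dec ¬? (y ∼? x)

  height : Fin n → ℕ
  height y = ∣ subset (_≺? y) ∣

  private
    level : ℕ → Subset n
    level m = subset (λ x → height x ℕ.≟ m)

    loop? : ∀ m → Dec (∃ λ x → height x ≡ m × x ∼ x)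
    loop? m = any? λ x → (height x ℕ.≟ m) ×-dec (x ∼? x)

    block : ℕ → Block n
    block m = level m ^ does (loop? m)

  representation : List (Block n)
  representation = filter (nonempty? ∘ set) (map block (upTo (suc n)))

  private
    ≺-trans : Transitive _≺_
    ≺-trans {x} {y} {z} (xy , ¬yx) (yz , ¬zy) = ∼-trans xy yz , ≁-trans ¬zy ¬yx

    ≺⇒height< : ∀ {x y} → x ≺ y → height x ℕ.< height y
    ≺⇒height< {x} {y} x≺y = p⊂q⇒∣p∣<∣q∣
      ( (λ z∈ → ∈-subset⁺ (_≺? y) (≺-trans (∈-subset⁻ (_≺? x) z∈) x≺y))
      , x , ∈-subset⁺ (_≺? y) x≺y
      , λ x∈ → let (p , q) = ∈-subset⁻ (_≺? x) x∈ in q p )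

    -- x and y are incomparable for ≺ exactly when x ∼ y and y ∼ x agree.
    agree⇒height≤ : ∀ {x y} → (x ∼ y → y ∼ x) → (y ∼ x → x ∼ y) →
                    height x ℕ.≤ height y
    agree⇒height≤ {x} {y} f g =
      p⊆q⇒∣p∣≤∣q∣ (λ z∈ → ∈-subset⁺ (_≺? y) (step (∈-subset⁻ (_≺? x) z∈)))
      where
      step : ∀ {z} → z ≺ x → z ≺ y
      step (zx , ¬xz) with x ∼? y
      ... | yes xy = ∼-trans zx xy , λ yz → ¬xz (∼-trans xy yz)
      ... | no ¬xy =
        decidable-stable (_ ∼? _) (λ ¬zy → ≁-trans ¬zy (¬xy ∘ g) zx) , ≁-trans (¬xy ∘ g) ¬xz

    height<⇒≺ : ∀ {x y} → height x ℕ.< height y → x ≺ y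
    height<⇒≺ {x} {y} hx<hy with x ∼? y | y ∼? x
    ... | yes xy | no ¬yx = xy , ¬yx
    ... | no ¬xy | yes yx = contradiction hx<hy (ℕ.<-asym (≺⇒height< (yx , ¬xy)))
    ... | yes xy | yes yx =
      contradiction hx<hy (ℕ.≤⇒≯ (agree⇒height≤ (λ _ → xy) (λ _ → yx)))
    ... | no ¬xy | no ¬yx =
      contradiction hx<hy
        (ℕ.≤⇒≯ (agree⇒height≤ (λ p → contradiction p ¬yx) (λ p → contradiction p ¬xy)))

    height≡⇒sym : ∀ {x y} → height x ≡ height y → x ∼ y → y ∼ x
    height≡⇒sym hx≡hy xy =
      decidable-stable (_ ∼? _) λ ¬yx → ℕ.<⇒≢ (≺⇒height< (xy , ¬yx)) hx≡hy

    height≡∧loop⇒∼ : ∀ {x z} → height x ≡ height z → z ∼ z → x ∼ z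
    height≡∧loop⇒∼ {x} {z} hx≡hz zz =
      decidable-stable (x ∼? z) λ ¬xz →
        ≁-trans (¬xz ∘ height≡⇒sym (sym hx≡hz)) ¬xz zz

    IsLevel : Block n → Set
    IsLevel b = ∃ λ m → b ≡ block m

    Below : Rel (Block n) 0ℓ
    Below b c = ∀ {x y} → x ∈ set b → y ∈ set c → height x ℕ.< height y

    ∈-level⁻ : ∀ {m x} → x ∈ level m → height x ≡ m
    ∈-level⁻ {m} = ∈-subset⁻ (λ x → height x ℕ.≟ m)

    isLevel : All IsLevel representation
    isLevel = All.filter⁺ (nonempty? ∘ set)
      (All.map⁺ (All.universal (λ m → m , refl) (upTo (suc n))))

    below : AllPairs Below representation
    below = AllPairs.filter⁺ (nonempty? ∘ set) (AllPairs.map⁺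
      (AllPairs.applyUpTo⁺₁ _ (suc n) λ i<j _ {x} {y} x∈ y∈ →
        subst (ℕ._< height y) (sym (∈-level⁻ x∈))
          (subst (_ ℕ.<_) (sym (∈-level⁻ y∈)) i<j)))

    union′ : ∀ x → Any (λ b → x ∈ set b) representation
    union′ x = lose
      (∈-filter⁺ (nonempty? ∘ set)
        (∈-map⁺ block (∈-upTo⁺ (s≤s (∣p∣≤n (subset (_≺? x)))))) (x , x∈))
      x∈
      where
      x∈ : x ∈ level (height x)
      x∈ = ∈-subset⁺ (λ y → height y ℕ.≟ height x) refl

    same-block⇒height≡ : ∀ {b x y} → IsLevel b → x ∈ set b → y ∈ set b →
                         height x ≡ height y
    same-block⇒height≡ (_ , refl) x∈ y∈ = trans (∈-level⁻ x∈) (sym (∈-level⁻ y∈))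

    underlined⁻ : ∀ {b x y} → IsLevel b → x ∈ set b → y ∈ set b →
                  underlined b ≡ true → x ∼ y
    underlined⁻ {x = x} {y} (m , refl) x∈ y∈ eq with loop? m
    ... | yes (z , hz≡m , zz) =
      ∼-trans (height≡∧loop⇒∼ (trans (∈-level⁻ x∈) (sym hz≡m)) zz)
              (height≡⇒sym hy≡hz (height≡∧loop⇒∼ hy≡hz zz))
      where hy≡hz = trans (∈-level⁻ y∈) (sym hz≡m)

    underlined⁺ : ∀ {b x y} → IsLevel b → x ∈ set b → y ∈ set b →
                  x ∼ y → underlined b ≡ true
    underlined⁺ {x = x} l@(m , refl) x∈ y∈ xy =
      dec-true (loop? m)
        (x , ∈-level⁻ x∈ , ∼-trans xy (height≡⇒sym (same-block⇒height≡ l x∈ y∈) xy))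

    sound : ∀ {x y} → ⟦ representation ⟧ x y → x ∼ y
    sound (inj₁ (i , j , i<j , x∈ , y∈)) =
      proj₁ (height<⇒≺ (AllPairs-lookup below i<j x∈ y∈))
    sound (inj₂ (i , x∈ , y∈ , eq)) = underlined⁻ (All.lookup isLevel (∈-lookup i)) x∈ y∈ eq

    complete : ∀ {x y} → x ∼ y → ⟦ representation ⟧ x y
    complete {x} {y} xy
      with Any.index (union′ x) | Any.lookup-index (union′ x)
         | Any.index (union′ y) | Any.lookup-index (union′ y)
    ... | i | x∈ | j | y∈ with Fin.<-cmp i j
    ... | tri< i<j _ _  = inj₁ (i , j , i<j , x∈ , y∈)
    ... | tri≈ _ refl _ =
      inj₂ (i , x∈ , y∈ , underlined⁺ (All.lookup isLevel (∈-lookup i)) x∈ y∈ xy)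
    ... | tri> _ _ j<i  =
      contradiction xy (proj₂ (height<⇒≺ (AllPairs-lookup below j<i y∈ x∈)))

  represents : Represents representation U
  represents = record
    { isOrderedBipartition = record
      { nonempty = All.all-filter (nonempty? ∘ set) _
      ; disjoint = AllPairs.map
          (λ b<c (x , x∈) → let (x∈b , x∈c) = x∈p∩q⁻ _ _ x∈ in
            ℕ.<-irrefl refl (b<c x∈b x∈c))
          below
      ; union    = union′
      }
    ; equivalent = sound , complete
    }

rk : {n : ℕ} → Bip n → ℤ
rk U = blocksRank (representation U)

{-# OPTIONS --safe #-}
module Submission where

-- If U < V then some move on the representation of U yields a relation still contained
-- in V.  Each move raises the rank by exactly 1 and stays in Bip, so, iterating moves,
-- the rank is strictly monotone.  Hence a move is a cover (there is no room for a relation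
-- in between), and conversely the move found below a cover V of U must produce V itself.
-- A maximal chain joins the empty relation to the full one by covers, which fixes its length.

open import Defs
open import Level using (Level; 0ℓ)
open import Data.Bool.Base using (true; false)
import Data.Bool.Properties as Bool
open import Data.Empty using (⊥; ⊥-elim)
open import Data.Fin.Base as Fin using (Fin; combine; remQuot)
import Data.Fin.Properties as Fin
open import Data.Fin.Subset
  using (Subset; _∈_; _⊆_; _⊂_; _∩_; _∪_; ⁅_⁆; ∣_∣; ⊤; Nonempty; Empty)
open import Data.Fin.Subset.Induction using (⊂-wellFounded)
open import Data.Fin.Subset.Properties
  using (_∈?_; ∈⊤; drop-∷-Empty; x∈p∩q⁺; x∈p∩q⁻; x∈p∪q⁺; x∈p∪q⁻;
         x∈⁅x⁆; x∈⁅y⁆⇒x≡y; ∣⁅x⁆∣≡1; ⊆-antisym)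
open import Data.Integer.Base as ℤ using (ℤ; +_; 0ℤ; 1ℤ)
import Data.Integer.Properties as ℤ
open import Data.Integer.Tactic.RingSolver using (solve-∀)
open import Data.List.Base using (List; []; _∷_; _++_; length; map)
open import Data.List.Membership.Propositional using (lose)
open import Data.List.Membership.Propositional.Properties using (∈-lookup)
open import Data.List.Relation.Unary.All as All using (All; []; _∷_)
open import Data.List.Relation.Unary.AllPairs as AllPairs using (AllPairs; []; _∷_)
open import Data.List.Relation.Unary.Any as Any using (Any; here; there; any?)
import Data.List.Relation.Unary.Any.Properties as Any
open import Data.List.Relation.Unary.Linked.Properties using (Linked⇒AllPairs)
open import Data.Nat.Base as ℕ using (ℕ; suc; NonZero; z≤n; s≤s)
open import Data.Nat.ListAction using (sum)
import Data.Nat.Properties as ℕ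
open import Data.Product.Base using (∃; ∃₂; _×_; _,_; proj₁; proj₂)
open import Data.Sum.Base using (_⊎_; inj₁; inj₂; [_,_]′)
open import Data.Unit.Base using (tt) renaming (⊤ to Unit)
import Data.Vec.Base as Vec
import Data.Vec.Properties as Vec
open import Data.Vec.Base using ([]; _∷_)
open import Function.Base using (_∘_)
open import Function.Bundles using (_⇔_; mk⇔)
open import Induction.WellFounded using (Acc; acc)
open import Relation.Binary.Bundles using (Poset)
open import Relation.Binary.Core using (Rel; _⇒_)
import Relation.Binary.Properties.Poset as PosetProperties
open import Relation.Binary.PropositionalEquality
  using (_≡_; _≢_; refl; sym; trans; cong; cong₂; subst; subst₂; module ≡-Reasoning)
open import Relation.Nullary
  using (¬_; Dec; yes; no; does; contradiction; ¬?; _×-dec_)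
open import Relation.Nullary.Decidable using (decidable-stable; dec-true)
import Relation.Unary as Pred

private
  variable
    n : ℕ
    b : Block n
    bs cs : List (Block n)
    B C : Subset n
    x y z : Fin n

-- Subsets of a finite set.

comprehension : {P : Pred.Pred (Fin n) 0ℓ} → Pred.Decidable P → Subset n
comprehension P? = Vec.tabulate (does ∘ P?)

module _ {P : Pred.Pred (Fin n) 0ℓ} (P? : Pred.Decidable P) where

  ∈-comprehension⁺ : P x → x ∈ comprehension P?
  ∈-comprehension⁺ {x} px = Vec.lookup⇒[]= x _
    (trans (Vec.lookup∘tabulate _ x) (dec-true (P? x) px))

  ∈-comprehension⁻ : x ∈ comprehension P? → P x
  ∈-comprehension⁻ {x} x∈ with P? x
    | trans (sym (Vec.lookup∘tabulate (does ∘ P?) x)) (Vec.[]=⇒lookup x∈)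
  ... | yes px | _ = px

∣p∪q∣≡∣p∣+∣q∣ : ∀ {n} (p q : Subset n) → Empty (p ∩ q) → ∣ p ∪ q ∣ ≡ ∣ p ∣ ℕ.+ ∣ q ∣
∣p∪q∣≡∣p∣+∣q∣ [] [] _ = refl
∣p∪q∣≡∣p∣+∣q∣ (false ∷ p) (false ∷ q) ∅ = ∣p∪q∣≡∣p∣+∣q∣ p q (drop-∷-Empty ∅)
∣p∪q∣≡∣p∣+∣q∣ (true  ∷ p) (false ∷ q) ∅ = cong suc (∣p∪q∣≡∣p∣+∣q∣ p q (drop-∷-Empty ∅))
∣p∪q∣≡∣p∣+∣q∣ (false ∷ p) (true  ∷ q) ∅ =
  trans (cong suc (∣p∪q∣≡∣p∣+∣q∣ p q (drop-∷-Empty ∅))) (sym (ℕ.+-suc ∣ p ∣ ∣ q ∣))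
∣p∪q∣≡∣p∣+∣q∣ (true  ∷ p) (true  ∷ q) ∅ = contradiction (Fin.zero , Vec.here) ∅

-- The relation of a list of blocks, by recursion on the list.

Supp : List (Block n) → Fin n → Set
Supp bs x = Any (λ b → x ∈ set b) bs

supp? : (bs : List (Block n)) → Pred.Decidable (Supp bs)
supp? bs x = any? (λ b → x ∈? set b) bs

-- The relation `⟦_⟧` again, with positions in the list replaced by constructors, so that arguments
-- can recurse on the first block.
data ⟪_⟫ {n : ℕ} : List (Block n) → Rel (Fin n) 0ℓ where
  later  : x ∈ set b → Supp bs y → ⟪ b ∷ bs ⟫ x y
  within : x ∈ set b → y ∈ set b → underlined b ≡ true → ⟪ b ∷ bs ⟫ x y
  there  : ⟪ bs ⟫ x y → ⟪ b ∷ bs ⟫ x y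

suppˡ : ⟪ bs ⟫ x y → Supp bs x
suppˡ (later x∈ _)    = here x∈
suppˡ (within x∈ _ _) = here x∈
suppˡ (there r)       = there (suppˡ r)

suppʳ : ⟪ bs ⟫ x y → Supp bs y
suppʳ (later _ y∈)    = there y∈
suppʳ (within _ y∈ _) = here y∈
suppʳ (there r)       = there (suppʳ r)

⟪⟫⇒⟦⟧ : ⟪ bs ⟫ ⇒ ⟦ bs ⟧
⟪⟫⇒⟦⟧ (later x∈ y∈) =
  inj₁ (Fin.zero , Fin.suc (Any.index y∈) , s≤s z≤n , x∈ , Any.lookup-index y∈)
⟪⟫⇒⟦⟧ (within x∈ y∈ u) = inj₂ (Fin.zero , x∈ , y∈ , u)
⟪⟫⇒⟦⟧ (there r) with ⟪⟫⇒⟦⟧ r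
... | inj₁ (i , j , i<j , p) = inj₁ (Fin.suc i , Fin.suc j , s≤s i<j , p)
... | inj₂ (i , p)           = inj₂ (Fin.suc i , p)

⟦⟧⇒⟪⟫ : ⟦ bs ⟧ ⇒ ⟪ bs ⟫
⟦⟧⇒⟪⟫ {bs = _ ∷ _} (inj₁ (Fin.zero , Fin.suc j , _ , x∈ , y∈)) =
  later x∈ (lose (∈-lookup j) y∈)
⟦⟧⇒⟪⟫ {bs = _ ∷ _} (inj₁ (Fin.suc i , Fin.suc j , s≤s i<j , p)) =
  there (⟦⟧⇒⟪⟫ (inj₁ (i , j , i<j , p)))
⟦⟧⇒⟪⟫ {bs = _ ∷ _} (inj₂ (Fin.zero , x∈ , y∈ , u)) = within x∈ y∈ u
⟦⟧⇒⟪⟫ {bs = _ ∷ _} (inj₂ (Fin.suc i , p))          = there (⟦⟧⇒⟪⟫ (inj₂ (i , p)))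

⟪⟫? : (bs : List (Block n)) → ∀ x y → Dec (⟪ bs ⟫ x y)
⟪⟫? []       x y = no λ ()
⟪⟫? (b ∷ bs) x y with ⟪⟫? bs x y | x ∈? set b
... | yes r | _ = yes (there r)
... | no ¬r | no x∉ = no λ where
  (later x∈ _)    → x∉ x∈
  (within x∈ _ _) → x∉ x∈
  (there r)       → ¬r r
... | no ¬r | yes x∈ with supp? bs y | (y ∈? set b) ×-dec (underlined b Bool.≟ true)
... | yes y∈ | _            = yes (later x∈ y∈)
... | no _   | yes (y∈ , u) = yes (within x∈ y∈ u)
... | no y∉  | no ¬w        = no λ where
  (later _ y∈)    → y∉ y∈
  (within _ y∈ u) → ¬w (y∈ , u)
  (there r)       → ¬r r

-- The union condition of an ordered bipartition is left out, so that tails are again `Ordered`; the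
-- set covered is tracked separately by `Supp`.
data Ordered {n : ℕ} : List (Block n) → Set where
  []   : Ordered []
  cons : Nonempty (set b) → (∀ {x} → x ∈ set b → ¬ Supp bs x) → Ordered bs →
         Ordered (b ∷ bs)

ordered : All (Nonempty ∘ set) bs → AllPairs (λ b c → Empty (set b ∩ set c)) bs →
          Ordered bs
ordered []       []       = []
ordered (e ∷ es) (d ∷ ds) = cons e
  (λ x∈b x∈bs → All.lookupWith (λ ∅ x∈c → ∅ (_ , x∈p∩q⁺ (x∈b , x∈c))) d x∈bs)
  (ordered es ds)

⟪⟫-trans : Ordered bs → ⟪ bs ⟫ x y → ⟪ bs ⟫ y z → ⟪ bs ⟫ x z
⟪⟫-trans (cons _ d _) (later _ y∈)     (later y∈b _)    = contradiction y∈ (d y∈b)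
⟪⟫-trans (cons _ d _) (later _ y∈)     (within y∈b _ _) = contradiction y∈ (d y∈b)
⟪⟫-trans _            (later x∈ _)     (there s)        = later x∈ (suppʳ s)
⟪⟫-trans _            (within x∈ _ _)  (later _ z∈)     = later x∈ z∈
⟪⟫-trans _            (within x∈ _ u)  (within _ z∈ _)  = within x∈ z∈ u
⟪⟫-trans (cons _ d _) (within _ y∈b _) (there s)        = contradiction (suppˡ s) (d y∈b)
⟪⟫-trans (cons _ d _) (there r)        (later y∈b _)    = contradiction (suppʳ r) (d y∈b)
⟪⟫-trans (cons _ d _) (there r)        (within y∈b _ _) = contradiction (suppʳ r) (d y∈b)
⟪⟫-trans (cons _ _ o) (there r)        (there s)        = there (⟪⟫-trans o r s)

-- A positive form of transitivity of the complement. If `y` is in the first block, `y` relates to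
-- `z`; if only `x` is, `x` relates to `y`; otherwise all three points are in the tail.
⟪⟫-cotrans : Supp bs y → ⟪ bs ⟫ x z → ⟪ bs ⟫ x y ⊎ ⟪ bs ⟫ y z
⟪⟫-cotrans (here y∈)  (later _ z∈)     = inj₂ (later y∈ z∈)
⟪⟫-cotrans (there y∈) (later x∈ _)     = inj₁ (later x∈ y∈)
⟪⟫-cotrans (here y∈)  (within _ z∈ u)  = inj₂ (within y∈ z∈ u)
⟪⟫-cotrans (there y∈) (within x∈ _ _)  = inj₁ (later x∈ y∈)
⟪⟫-cotrans (here y∈)  (there r)        = inj₂ (later y∈ (suppʳ r))
⟪⟫-cotrans (there y∈) (there r) with ⟪⟫-cotrans y∈ r
... | inj₁ s = inj₁ (there s)
... | inj₂ s = inj₂ (there s)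

-- Uniqueness of the representation.

⟪⟫-tail : Supp bs x → (∀ {z} → z ∈ set b → ¬ Supp bs z) → ⟪ b ∷ cs ⟫ x y → ⟪ cs ⟫ x y
⟪⟫-tail x∈ d (later x∈b _)    = contradiction x∈ (d x∈b)
⟪⟫-tail x∈ d (within x∈b _ _) = contradiction x∈ (d x∈b)
⟪⟫-tail x∈ d (there r)        = r

Supp-tail : Supp bs x → (∀ {z} → z ∈ set b → ¬ Supp bs z) → Supp (b ∷ cs) x → Supp cs x
Supp-tail x∈ d (here x∈b) = contradiction x∈ (d x∈b)
Supp-tail x∈ d (there x∈cs) = x∈cs

-- The first block consists of the elements of the support that nothing strictly precedes.
head⊆head : ∀ {c} → Ordered (b ∷ bs) → Ordered (c ∷ cs) →
            (∀ {x} → Supp (b ∷ bs) x → Supp (c ∷ cs) x) →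
            ⟪ b ∷ bs ⟫ ⇒ ⟪ c ∷ cs ⟫ → ⟪ c ∷ cs ⟫ ⇒ ⟪ b ∷ bs ⟫ → set b ⊆ set c
head⊆head (cons _ d _) (cons (z , z∈c) e _) S f g x∈b with S (here x∈b)
... | here x∈c   = x∈c
... | there x∈cs with g (later z∈c x∈cs)
...   | later _ x∈bs      = contradiction x∈bs (d x∈b)
...   | there r           = contradiction (suppʳ r) (d x∈b)
-- An underlined block is symmetric, so `x` would also be related to `z` in `c ∷ cs`, where `z` lies
-- in a strictly earlier block.
...   | within z∈b _ u    = contradiction (suppʳ (⟪⟫-tail x∈cs e (f (within x∈b z∈b u)))) (e z∈c)

head-underlined : ∀ {ε δ} → Ordered ((B ^ δ) ∷ cs) → x ∈ B →
  ⟪ (B ^ ε) ∷ bs ⟫ ⇒ ⟪ (B ^ δ) ∷ cs ⟫ → ε ≡ true → δ ≡ true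
head-underlined (cons _ d _) x∈ f u with f (within x∈ x∈ u)
... | later _ x∈cs  = contradiction x∈cs (d x∈)
... | within _ _ u′ = u′
... | there r       = contradiction (suppˡ r) (d x∈)

-- The relation determines the first set, and whether its elements are related to themselves
-- determines the underlining; the tails are then compared. Equal supports must be assumed: the
-- empty list and a single nonunderlined block both give the empty relation.
⟪⟫-injective : Ordered bs → Ordered cs →
  (∀ {x} → Supp bs x → Supp cs x) → (∀ {x} → Supp cs x → Supp bs x) →
  ⟪ bs ⟫ ⇒ ⟪ cs ⟫ → ⟪ cs ⟫ ⇒ ⟪ bs ⟫ → bs ≡ cs
⟪⟫-injective [] [] _ _ _ _ = refl
⟪⟫-injective [] (cons (_ , x∈) _ _) _ T _ _ = contradiction (T (here x∈)) λ ()
⟪⟫-injective (cons (_ , x∈) _ _) [] S _ _ _ = contradiction (S (here x∈)) λ ()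
⟪⟫-injective {bs = (B ^ ε) ∷ bs} {cs = (C ^ δ) ∷ cs} o@(cons (_ , x∈) d o′) p@(cons _ e p′) S T f g
  with refl ← ⊆-antisym {i = B} {C} (head⊆head o p S f g) (head⊆head p o T g f) =
  cong₂ (λ α as → (B ^ α) ∷ as)
    (Bool.⇔→≡ (mk⇔ (head-underlined p x∈ f) (head-underlined o x∈ g)))
    (⟪⟫-injective o′ p′
      (λ x∈bs → Supp-tail x∈bs d (S (there x∈bs)))
      (λ x∈cs → Supp-tail x∈cs e (T (there x∈cs)))
      (λ r → ⟪⟫-tail (suppˡ r) d (f (there r)))
      (λ r → ⟪⟫-tail (suppˡ r) e (g (there r))))

-- Passing between relations and lists of blocks.

fromBlocks : (bs : List (Block n)) → Ordered bs → (∀ x → Supp bs x) → Bip n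
fromBlocks bs o full = record
  { _∼_     = ⟪ bs ⟫
  ; _∼?_    = ⟪⟫? bs
  ; ∼-trans = ⟪⟫-trans o
  ; ≁-trans = λ ¬xy ¬yz xz → [ ¬xy , ¬yz ]′ (⟪⟫-cotrans (full _) xz)
  }

module _ (U : Bip n) where
  open Represents (represents U)
  open IsOrderedBipartition isOrderedBipartition

  representation-ordered : Ordered (representation U)
  representation-ordered = ordered nonempty disjoint

  representation-full : ∀ x → Supp (representation U) x
  representation-full = union

  representation⇒ : ⟪ representation U ⟫ ⇒ Bip._∼_ U
  representation⇒ = proj₁ equivalent ∘ ⟪⟫⇒⟦⟧

  representation⇐ : Bip._∼_ U ⇒ ⟪ representation U ⟫
  representation⇐ = ⟦⟧⇒⟪⟫ ∘ proj₂ equivalent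

  representation-unique : Ordered bs → (∀ x → Supp bs x) →
    ⟪ bs ⟫ ⇒ Bip._∼_ U → Bip._∼_ U ⇒ ⟪ bs ⟫ → representation U ≡ bs
  representation-unique o full f g = ⟪⟫-injective representation-ordered o
    (λ _ → full _) (λ _ → representation-full _)
    (g ∘ representation⇒) (representation⇐ ∘ f)

module _ {n : ℕ} where
  open Poset (Bip-poset n) public using (_≈_; _≤_) renaming (trans to ≤-trans)
  open PosetProperties (Bip-poset n) public using (_<_)

representation-cong : {U V : Bip n} → U ≈ V → representation U ≡ representation V
representation-cong {U = U} {V} (f , g) =
  representation-unique U (representation-ordered V) (representation-full V)
    (g ∘ representation⇒ V) (representation⇐ V ∘ f)

-- Moves and what they preserve.

-- Move with the common prefix peeled off block by block.
data Move′ {n : ℕ} : Rel (List (Block n)) 0ℓ where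
  join      : Move′ ((B ^ true) ∷ (C ^ true) ∷ cs) ((B ∪ C ^ true) ∷ cs)
  separate  : Nonempty B → Nonempty C → Empty (B ∩ C) →
              Move′ ((B ∪ C ^ false) ∷ cs) ((B ^ false) ∷ (C ^ false) ∷ cs)
  underline : Move′ ((⁅ x ⁆ ^ false) ∷ cs) ((⁅ x ⁆ ^ true) ∷ cs)
  there     : Move′ bs cs → Move′ (b ∷ bs) (b ∷ cs)

++-Move′ : ∀ (as : List (Block n)) → Move′ bs cs → Move′ (as ++ bs) (as ++ cs)
++-Move′ []       m = m
++-Move′ (a ∷ as) m = there (++-Move′ as m)

Move⇒Move′ : Move bs cs → Move′ bs cs
Move⇒Move′ (join as _ _ _)           = ++-Move′ as join
Move⇒Move′ (separate as _ _ _ p q r) = ++-Move′ as (separate p q r)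
Move⇒Move′ (underline as _ _)        = ++-Move′ as underline

Move-∷ : Move bs cs → Move (b ∷ bs) (b ∷ cs)
Move-∷ {b = b} (join as cs B C)           = join (b ∷ as) cs B C
Move-∷ {b = b} (separate as cs B C p q r) = separate (b ∷ as) cs B C p q r
Move-∷ {b = b} (underline as cs x)        = underline (b ∷ as) cs x

Move′⇒Move : Move′ bs cs → Move bs cs
Move′⇒Move join             = join [] _ _ _
Move′⇒Move (separate p q r) = separate [] _ _ _ p q r
Move′⇒Move underline        = underline [] _ _
Move′⇒Move (there m)        = Move-∷ (Move′⇒Move m)

Supp-∪⁺ : ∀ {ε δ γ} → Supp ((B ^ ε) ∷ (C ^ δ) ∷ cs) x → Supp ((B ∪ C ^ γ) ∷ cs) x
Supp-∪⁺ (here x∈)          = here (x∈p∪q⁺ (inj₁ x∈))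
Supp-∪⁺ (there (here x∈))  = here (x∈p∪q⁺ (inj₂ x∈))
Supp-∪⁺ (there (there x∈)) = there x∈

Supp-∪⁻ : ∀ {ε δ γ} → Supp ((B ∪ C ^ γ) ∷ cs) x → Supp ((B ^ ε) ∷ (C ^ δ) ∷ cs) x
Supp-∪⁻ {B = B} {C} (here x∈) with x∈p∪q⁻ B C x∈
... | inj₁ x∈B = here x∈B
... | inj₂ x∈C = there (here x∈C)
Supp-∪⁻ (there x∈) = there (there x∈)

Move′-supp⁺ : Move′ bs cs → Supp bs x → Supp cs x
Move′-supp⁺ join             = Supp-∪⁺
Move′-supp⁺ (separate _ _ _) = Supp-∪⁻
Move′-supp⁺ underline        (here x∈)  = here x∈
Move′-supp⁺ underline        (there x∈) = there x∈
Move′-supp⁺ (there m)        (here x∈)  = here x∈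
Move′-supp⁺ (there m)        (there x∈) = there (Move′-supp⁺ m x∈)

Move′-supp⁻ : Move′ bs cs → Supp cs x → Supp bs x
Move′-supp⁻ join             = Supp-∪⁻
Move′-supp⁻ (separate _ _ _) = Supp-∪⁺
Move′-supp⁻ underline        (here x∈)  = here x∈
Move′-supp⁻ underline        (there x∈) = there x∈
Move′-supp⁻ (there m)        (here x∈)  = here x∈
Move′-supp⁻ (there m)        (there x∈) = there (Move′-supp⁻ m x∈)

Move′-ordered : Move′ bs cs → Ordered bs → Ordered cs
Move′-ordered {bs = (B ^ _) ∷ (C ^ _) ∷ _} join (cons (x , x∈) d (cons _ e o)) =
  cons (x , x∈p∪q⁺ (inj₁ x∈))
    (λ z∈ z∈cs → [ (λ z∈B → d z∈B (there z∈cs)) , (λ z∈C → e z∈C z∈cs) ]′ (x∈p∪q⁻ B C z∈)) o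
Move′-ordered (separate p q ∅) (cons _ d o) =
  cons p
    (λ where z∈B (here z∈C)   → ∅ (_ , x∈p∩q⁺ (z∈B , z∈C))
             z∈B (there z∈cs) → d (x∈p∪q⁺ (inj₁ z∈B)) z∈cs)
    (cons q (d ∘ x∈p∪q⁺ ∘ inj₂) o)
Move′-ordered underline (cons p d o) = cons p d o
Move′-ordered (there m) (cons p d o) =
  cons p (λ x∈ x∈cs → d x∈ (Move′-supp⁻ m x∈cs)) (Move′-ordered m o)

Move′-⇒ : Move′ bs cs → ⟪ bs ⟫ ⇒ ⟪ cs ⟫
Move′-⇒ join (later x∈ (here y∈))       = within (x∈p∪q⁺ (inj₁ x∈)) (x∈p∪q⁺ (inj₂ y∈)) refl
Move′-⇒ join (later x∈ (there y∈))      = later (x∈p∪q⁺ (inj₁ x∈)) y∈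
Move′-⇒ join (within x∈ y∈ _)           = within (x∈p∪q⁺ (inj₁ x∈)) (x∈p∪q⁺ (inj₁ y∈)) refl
Move′-⇒ join (there (later x∈ y∈))      = later (x∈p∪q⁺ (inj₂ x∈)) y∈
Move′-⇒ join (there (within x∈ y∈ _))   = within (x∈p∪q⁺ (inj₂ x∈)) (x∈p∪q⁺ (inj₂ y∈)) refl
Move′-⇒ join (there (there r))          = there r
Move′-⇒ {cs = (B ^ _) ∷ (C ^ _) ∷ _} (separate _ _ _) (later x∈ y∈) with x∈p∪q⁻ B C x∈
... | inj₁ x∈B = later x∈B (there y∈)
... | inj₂ x∈C = there (later x∈C y∈)
Move′-⇒ (separate _ _ _) (there r)      = there (there r)
Move′-⇒ underline (later x∈ y∈)         = later x∈ y∈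
Move′-⇒ underline (there r)             = there r
Move′-⇒ (there m) (later x∈ y∈)         = later x∈ (Move′-supp⁺ m y∈)
Move′-⇒ (there m) (within x∈ y∈ u)      = within x∈ y∈ u
Move′-⇒ (there m) (there r)             = there (Move′-⇒ m r)

-- The effect of a move on the rank.

weight : Block n → ℤ
weight (B ^ true)  = + 3 ℤ.* + ∣ B ∣ ℤ.- 1ℤ
weight (B ^ false) = 1ℤ

blocksRank-∷ : ∀ (b : Block n) bs → blocksRank (b ∷ bs) ≡ weight b ℤ.+ blocksRank bs
blocksRank-∷ (B ^ true) bs =
  identity (+ ∣ B ∣) (+ sum (map (∣_∣ ∘ set) (blocksWith true bs)))
    (+ length (blocksWith false bs)) (+ length (blocksWith true bs))
  where
  identity : ∀ p s f u →
    + 3 ℤ.* (p ℤ.+ s) ℤ.+ f ℤ.- (1ℤ ℤ.+ u) ℤ.- 1ℤ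
    ≡ (+ 3 ℤ.* p ℤ.- 1ℤ) ℤ.+ (+ 3 ℤ.* s ℤ.+ f ℤ.- u ℤ.- 1ℤ)
  identity = solve-∀
blocksRank-∷ (B ^ false) bs =
  identity (+ sum (map (∣_∣ ∘ set) (blocksWith true bs)))
    (+ length (blocksWith false bs)) (+ length (blocksWith true bs))
  where
  identity : ∀ s f u →
    + 3 ℤ.* s ℤ.+ (1ℤ ℤ.+ f) ℤ.- u ℤ.- 1ℤ
    ≡ 1ℤ ℤ.+ (+ 3 ℤ.* s ℤ.+ f ℤ.- u ℤ.- 1ℤ)
  identity = solve-∀

-- For disjoint blocks of sizes p and q, joining replaces (3p - 1) + (3q - 1) by 3(p + q) - 1.
-- Separating replaces one block of weight 1 by two, and underlining a singleton replaces weight 1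
-- by 3 - 1 = 2.
Move′-rank : Ordered bs → Move′ bs cs → blocksRank cs ≡ blocksRank bs ℤ.+ 1ℤ
Move′-rank {bs = (B ^ _) ∷ (C ^ _) ∷ cs} (cons _ d _) join = begin
  blocksRank ((B ∪ C ^ true) ∷ cs)
    ≡⟨ blocksRank-∷ (B ∪ C ^ true) cs ⟩
  + 3 ℤ.* + ∣ B ∪ C ∣ ℤ.- 1ℤ ℤ.+ r
    ≡⟨ cong (λ k → + 3 ℤ.* + k ℤ.- 1ℤ ℤ.+ r) (∣p∪q∣≡∣p∣+∣q∣ B C disjoint) ⟩
  + 3 ℤ.* (+ ∣ B ∣ ℤ.+ + ∣ C ∣) ℤ.- 1ℤ ℤ.+ r
    ≡⟨ identity (+ ∣ B ∣) (+ ∣ C ∣) r ⟩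
  weight (B ^ true) ℤ.+ (weight (C ^ true) ℤ.+ r) ℤ.+ 1ℤ
    ≡⟨ cong (λ k → weight (B ^ true) ℤ.+ k ℤ.+ 1ℤ) (blocksRank-∷ (C ^ true) cs) ⟨
  weight (B ^ true) ℤ.+ blocksRank ((C ^ true) ∷ cs) ℤ.+ 1ℤ
    ≡⟨ cong (ℤ._+ 1ℤ) (blocksRank-∷ (B ^ true) ((C ^ true) ∷ cs)) ⟨
  blocksRank ((B ^ true) ∷ (C ^ true) ∷ cs) ℤ.+ 1ℤ ∎
  where
  open ≡-Reasoning
  r = blocksRank cs
  disjoint : Empty (B ∩ C)
  disjoint (_ , x∈) = d (proj₁ (x∈p∩q⁻ B C x∈)) (here (proj₂ (x∈p∩q⁻ B C x∈)))
  identity : ∀ p q r → + 3 ℤ.* (p ℤ.+ q) ℤ.- 1ℤ ℤ.+ r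
    ≡ (+ 3 ℤ.* p ℤ.- 1ℤ) ℤ.+ (+ 3 ℤ.* q ℤ.- 1ℤ ℤ.+ r) ℤ.+ 1ℤ
  identity = solve-∀
Move′-rank {cs = (B ^ _) ∷ (C ^ _) ∷ cs} _ (separate _ _ _) = begin
  blocksRank ((B ^ false) ∷ (C ^ false) ∷ cs)
    ≡⟨ blocksRank-∷ (B ^ false) ((C ^ false) ∷ cs) ⟩
  1ℤ ℤ.+ blocksRank ((C ^ false) ∷ cs)
    ≡⟨ cong (λ k → 1ℤ ℤ.+ k) (blocksRank-∷ (C ^ false) cs) ⟩
  1ℤ ℤ.+ (1ℤ ℤ.+ blocksRank cs)
    ≡⟨ ℤ.+-comm 1ℤ (1ℤ ℤ.+ blocksRank cs) ⟩
  1ℤ ℤ.+ blocksRank cs ℤ.+ 1ℤ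
    ≡⟨ cong (ℤ._+ 1ℤ) (blocksRank-∷ (B ∪ C ^ false) cs) ⟨
  blocksRank ((B ∪ C ^ false) ∷ cs) ℤ.+ 1ℤ ∎
  where open ≡-Reasoning
Move′-rank {bs = _ ∷ cs} _ (underline {x = x}) = begin
  blocksRank ((⁅ x ⁆ ^ true) ∷ cs)
    ≡⟨ blocksRank-∷ (⁅ x ⁆ ^ true) cs ⟩
  + 3 ℤ.* + ∣ ⁅ x ⁆ ∣ ℤ.- 1ℤ ℤ.+ blocksRank cs
    ≡⟨ cong (λ k → + 3 ℤ.* + k ℤ.- 1ℤ ℤ.+ blocksRank cs) (∣⁅x⁆∣≡1 x) ⟩
  + 2 ℤ.+ blocksRank cs
    ≡⟨ identity (blocksRank cs) ⟩
  1ℤ ℤ.+ blocksRank cs ℤ.+ 1ℤ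
    ≡⟨ cong (ℤ._+ 1ℤ) (blocksRank-∷ (⁅ x ⁆ ^ false) cs) ⟨
  blocksRank ((⁅ x ⁆ ^ false) ∷ cs) ℤ.+ 1ℤ ∎
  where
  open ≡-Reasoning
  identity : ∀ r → + 2 ℤ.+ r ≡ 1ℤ ℤ.+ r ℤ.+ 1ℤ
  identity = solve-∀
Move′-rank {bs = b ∷ bs} {cs = _ ∷ cs} (cons _ _ o) (there m) = begin
  blocksRank (b ∷ cs)                         ≡⟨ blocksRank-∷ b cs ⟩
  weight b ℤ.+ blocksRank cs                  ≡⟨ cong (λ k → weight b ℤ.+ k) (Move′-rank o m) ⟩
  weight b ℤ.+ (blocksRank bs ℤ.+ 1ℤ)         ≡⟨ ℤ.+-assoc (weight b) (blocksRank bs) 1ℤ ⟨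
  weight b ℤ.+ blocksRank bs ℤ.+ 1ℤ           ≡⟨ cong (ℤ._+ 1ℤ) (blocksRank-∷ b bs) ⟨
  blocksRank (b ∷ bs) ℤ.+ 1ℤ                  ∎
  where open ≡-Reasoning

-- Finding a move that stays inside a given relation.

module _ (V : Bip n) where
  open Bip V

  Advance : List (Block n) → Set
  Advance bs = ∃ λ cs → Move′ bs cs × (∀ {x y} → ⟪ cs ⟫ x y → x ∼ y)

  -- B is cut into B ∖ C and C where C = { z ∈ B : x ∼ z, z ≠ x }; cotransitivity
  -- applied to x ∼ c and x ≁ z gives z ∼ c for z ∈ B ∖ C and c ∈ C.
  advance-separate : ⟪ (B ^ false) ∷ bs ⟫ ⇒ _∼_ → x ∈ B → y ∈ B → x ∼ y → x ≢ y →
                     Advance ((B ^ false) ∷ bs)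
  advance-separate {B} {bs} {x} {y} f x∈B y∈B xy x≢y =
    -- `separate` applies only to a block of the literal form of a union, so `B` is first rewritten
    -- as `L ∪ R`.
    subst (λ S → Advance ((S ^ false) ∷ bs)) (sym B≡L∪R)
      ( _
      , separate (x , ∈-comprehension⁺ left? (x∈B , λ (_ , x≢x) → x≢x refl))
                 (y , ∈-comprehension⁺ right? (y∈B , xy , x≢y))
                 (λ (_ , z∈) → let z∈L , z∈R = x∈p∩q⁻ L R z∈ in
                   proj₂ (left⁻ z∈L) (proj₂ (right⁻ z∈R)))
      , g )
    where
    above? : Pred.Decidable (λ z → x ∼ z × x ≢ z)
    above? z = (x ∼? z) ×-dec ¬? (x Fin.≟ z)

    left? : Pred.Decidable (λ z → z ∈ B × ¬ (x ∼ z × x ≢ z))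
    left? z = (z ∈? B) ×-dec ¬? (above? z)

    right? : Pred.Decidable (λ z → z ∈ B × (x ∼ z × x ≢ z))
    right? z = (z ∈? B) ×-dec above? z

    L R : Subset n
    L = comprehension left?
    R = comprehension right?

    left⁻ : z ∈ L → z ∈ B × ¬ (x ∼ z × x ≢ z)
    left⁻ = ∈-comprehension⁻ left?

    right⁻ : z ∈ R → z ∈ B × (x ∼ z × x ≢ z)
    right⁻ = ∈-comprehension⁻ right?

    B⊆L∪R : B ⊆ L ∪ R
    B⊆L∪R {z} z∈B with above? z
    ... | yes a = x∈p∪q⁺ (inj₂ (∈-comprehension⁺ right? (z∈B , a)))
    ... | no ¬a = x∈p∪q⁺ (inj₁ (∈-comprehension⁺ left? (z∈B , ¬a)))

    B≡L∪R : B ≡ L ∪ R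
    B≡L∪R = ⊆-antisym B⊆L∪R
      λ z∈ → [ proj₁ ∘ left⁻ , proj₁ ∘ right⁻ ]′ (x∈p∪q⁻ L R z∈)

    g : ⟪ (L ^ false) ∷ (R ^ false) ∷ bs ⟫ ⇒ _∼_
    g {z} {w} (later z∈L (here w∈R)) with x Fin.≟ z
    ... | yes refl = proj₁ (proj₂ (right⁻ w∈R))
    ... | no x≢z   = decidable-stable (z ∼? w) λ ¬zw →
      ≁-trans (λ xz → proj₂ (left⁻ z∈L) (xz , x≢z)) ¬zw (proj₁ (proj₂ (right⁻ w∈R)))
    g (later z∈L (there w∈))  = f (later (proj₁ (left⁻ z∈L)) w∈)
    g (there (later z∈R w∈))  = f (later (proj₁ (right⁻ z∈R)) w∈)
    g (there (there r))       = f (there r)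

  advance-underline : ⟪ (⁅ x ⁆ ^ false) ∷ bs ⟫ ⇒ _∼_ → x ∼ x → Advance ((⁅ x ⁆ ^ false) ∷ bs)
  advance-underline {x} {bs} f xx = _ , underline , g
    where
    g : ⟪ (⁅ x ⁆ ^ true) ∷ bs ⟫ ⇒ _∼_
    g (later z∈ w∈)    = f (later z∈ w∈)
    g (there r)        = f (there r)
    g (within z∈ w∈ _) = subst₂ _∼_ (sym (x∈⁅y⁆⇒x≡y x z∈)) (sym (x∈⁅y⁆⇒x≡y x w∈)) xx

  -- Two distinct related elements of `B` allow a cut. If instead `x ∼ x` and `B` has another
  -- element `z`, then `x ∼ z` or `z ∼ x`, since otherwise transitivity of the complement would deny
  -- `x ∼ x`; again a cut is possible. If there is no such `z`, `B` is a singleton and can be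
  -- underlined.
  advance-nonunderlined : ⟪ (B ^ false) ∷ bs ⟫ ⇒ _∼_ → x ∈ B → y ∈ B → x ∼ y →
                          Advance ((B ^ false) ∷ bs)
  advance-nonunderlined {B} {bs} {x} {y} f x∈B y∈B xy with x Fin.≟ y
  ... | no x≢y   = advance-separate f x∈B y∈B xy x≢y
  ... | yes refl with Fin.any? (λ z → (z ∈? B) ×-dec ¬? (x Fin.≟ z))
  ...   | yes (z , z∈B , x≢z) with x ∼? z
  ...     | yes xz = advance-separate f x∈B z∈B xz x≢z
  ...     | no ¬xz = advance-separate f z∈B x∈B
                       (decidable-stable (z ∼? x) λ ¬zx → ≁-trans ¬xz ¬zx xy) (x≢z ∘ sym)
  advance-nonunderlined {B} {bs} {x} f x∈B _ xx | yes refl | no ∄ =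
    subst (λ S → Advance ((S ^ false) ∷ bs)) (sym B≡⁅x⁆)
      (advance-underline (λ {z} {w} → subst (λ S → ⟪ (S ^ false) ∷ bs ⟫ z w → z ∼ w) B≡⁅x⁆ f) xx)
    where
    B⊆⁅x⁆ : B ⊆ ⁅ x ⁆
    B⊆⁅x⁆ {z} z∈B with x Fin.≟ z
    ... | yes refl = x∈⁅x⁆ x
    ... | no x≢z   = contradiction (z , z∈B , x≢z) ∄

    B≡⁅x⁆ : B ≡ ⁅ x ⁆
    B≡⁅x⁆ = ⊆-antisym B⊆⁅x⁆ λ z∈ → subst (_∈ B) (sym (x∈⁅y⁆⇒x≡y x z∈)) x∈B

  -- The only pairs that joining can add lead from `C` back to `B`, and `h` supplies these.
  advance-join : ⟪ (B ^ true) ∷ (C ^ true) ∷ bs ⟫ ⇒ _∼_ →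
                 (∀ {z w} → z ∈ C → w ∈ B → z ∼ w) →
                 Advance ((B ^ true) ∷ (C ^ true) ∷ bs)
  advance-join {B} {C} {bs} f h = _ , join , g
    where
    g : ⟪ (B ∪ C ^ true) ∷ bs ⟫ ⇒ _∼_
    g (later z∈ w∈) with x∈p∪q⁻ B C z∈
    ... | inj₁ z∈B = f (later z∈B (there w∈))
    ... | inj₂ z∈C = f (there (later z∈C w∈))
    g (within z∈ w∈ _) with x∈p∪q⁻ B C z∈ | x∈p∪q⁻ B C w∈
    ... | inj₁ z∈B | inj₁ w∈B = f (within z∈B w∈B refl)
    ... | inj₁ z∈B | inj₂ w∈C = f (later z∈B (here w∈C))
    ... | inj₂ z∈C | inj₁ w∈B = h z∈C w∈B
    ... | inj₂ z∈C | inj₂ w∈C = f (there (within z∈C w∈C refl))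
    g (there r) = f (there (there r))

  advance-there : ⟪ b ∷ bs ⟫ ⇒ _∼_ → Advance bs → Advance (b ∷ bs)
  advance-there {b} {bs} f (cs , m , h) = b ∷ cs , there m , g
    where
    g : ⟪ b ∷ cs ⟫ ⇒ _∼_
    g (later z∈ w∈)    = f (later z∈ (Move′-supp⁻ m w∈))
    g (within z∈ w∈ u) = f (within z∈ w∈ u)
    g (there r)        = h r

  -- In the last cases y strictly precedes x, but x ∼ y.  Then every element from the
  -- block of y to that of x is related to itself: either one of the first two blocks
  -- is nonunderlined, and can be advanced, or they can be joined.
  advance : Ordered bs → ⟪ bs ⟫ ⇒ _∼_ → Supp bs x → Supp bs y →
            x ∼ y → ¬ ⟪ bs ⟫ x y → Advance bs
  advance (cons _ _ o) f (there x∈) (there y∈) xy ¬r =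
    advance-there f (advance o (f ∘ there) x∈ y∈ xy (¬r ∘ there))
  advance _ f (here x∈) (there y∈) xy ¬r = contradiction (later x∈ y∈) ¬r
  advance {(B ^ true)  ∷ _} _ f (here x∈) (here y∈) xy ¬r = contradiction (within x∈ y∈ refl) ¬r
  advance {(B ^ false) ∷ _} _ f (here x∈) (here y∈) xy ¬r = advance-nonunderlined f x∈ y∈ xy
  advance {(B ^ false) ∷ _} _ f (there x∈) (here y∈) xy _ =
    advance-nonunderlined f y∈ y∈ (∼-trans (f (later y∈ x∈)) xy)
  advance {(B ^ true) ∷ (C ^ false) ∷ _} _ f (there (here x∈)) (here y∈) xy _ =
    advance-there f (advance-nonunderlined (f ∘ there) x∈ x∈
      (∼-trans xy (f (later y∈ (here x∈)))))
  advance {(B ^ true) ∷ (C ^ false) ∷ _} (cons _ _ (cons (_ , z∈) _ _))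
          f (there (there x∈)) (here y∈) xy _ =
    -- Here `z` is any element of `C`; it lies strictly between `y` and `x`, and the cycle
    -- `z ∼ x ∼ y ∼ z` relates it to itself.
    advance-there f (advance-nonunderlined (f ∘ there) z∈ z∈
      (∼-trans (f (there (later z∈ x∈))) (∼-trans xy (f (later y∈ (here z∈))))))
  advance {(B ^ true) ∷ (C ^ true) ∷ bs} {x} _ f (there x∈) (here y∈) xy _ =
    -- The path is `z ∼ x ∼ y ∼ w`: `C` comes no later than the block of `x`, and `y` and `w` share
    -- the underlined block `B`.
    advance-join f λ z∈C w∈B → ∼-trans (C∼x z∈C x∈) (∼-trans xy (f (within y∈ w∈B refl)))
    where
    C∼x : z ∈ C → Supp ((C ^ true) ∷ bs) x → z ∼ x
    C∼x z∈ (here x∈)  = f (there (within z∈ x∈ refl))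
    C∼x z∈ (there x∈) = f (there (later z∈ x∈))

-- Moves and the strict order.

-- A finite search turns failure of inclusion into an explicit pair, the input that `advance`
-- requires.
difference? : (U V : Bip n) → (∃₂ λ x y → Bip._∼_ V x y × ¬ Bip._∼_ U x y) ⊎ V ≤ U
difference? U V with Fin.any? (λ x → Fin.any? (λ y → Bip._∼?_ V x y ×-dec ¬? (Bip._∼?_ U x y)))
... | yes (x , y , p) = inj₁ (x , y , p)
... | no ∄ = inj₂ λ {x} {y} xy →
  decidable-stable (Bip._∼?_ U x y) λ ¬xy → ∄ (x , y , xy , ¬xy)

<⇒difference : {U V : Bip n} → U < V → ∃₂ λ x y → Bip._∼_ V x y × ¬ Bip._∼_ U x y
<⇒difference {U = U} {V} (U≤V , U≉V) with difference? U V
... | inj₁ p   = p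
... | inj₂ V≤U = contradiction ((λ {_} {_} → U≤V) , (λ {_} {_} → V≤U)) U≉V

≤⇒<⊎≈ : {U V : Bip n} → U ≤ V → U < V ⊎ U ≈ V
≤⇒<⊎≈ {U = U} {V} U≤V with difference? U V
... | inj₁ (_ , _ , xVy , ¬xUy) = inj₁ ((λ {_} {_} → U≤V) , λ (_ , V≤U) → ¬xUy (V≤U xVy))
... | inj₂ V≤U = inj₂ ((λ {_} {_} → U≤V) , (λ {_} {_} → V≤U))

Move⇒rank : (U V : Bip n) → Move (representation U) (representation V) → rk V ≡ rk U ℤ.+ 1ℤ
Move⇒rank U V m = Move′-rank (representation-ordered U) (Move⇒Move′ m)

rk-cong : {U V : Bip n} → U ≈ V → rk U ≡ rk V
rk-cong {U = U} {V} U≈V = cong blocksRank (representation-cong {U = U} {V} U≈V)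

-- The inclusion is strict because equivalent relations have equal rank, whereas a move raises the
-- rank.
Move⇒< : (U V : Bip n) → Move (representation U) (representation V) → U < V
Move⇒< U V m =
  (λ xy → representation⇒ V (Move′-⇒ (Move⇒Move′ m) (representation⇐ U xy))) ,
  λ U≈V → ℤ.i≢suc[i] (trans (rk-cong {U = U} {V} U≈V)
    (trans (Move⇒rank U V m) (ℤ.+-comm (rk U) 1ℤ)))

-- A pair in `V` but not in `U` drives `advance`. By uniqueness, the list of blocks it returns is
-- the representation of the relation `W` that the list defines.
<⇒Move : (U V : Bip n) → U < V →
  ∃ λ W → Move (representation U) (representation W) × W ≤ V
<⇒Move U V U<V@(U≤V , _) with x , y , xVy , ¬xUy ← <⇒difference {U = U} {V} U<V
  with cs , m , cs⇒V ← advance V (representation-ordered U) (U≤V ∘ representation⇒ U)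
         (representation-full U x) (representation-full U y) xVy (¬xUy ∘ representation⇒ U) =
  W , subst (Move (representation U)) (sym (representation-unique W o full (λ r → r) (λ r → r)))
        (Move′⇒Move m)
    , cs⇒V
  where
  o : Ordered cs
  o = Move′-ordered m (representation-ordered U)
  full : ∀ x → Supp cs x
  full x = Move′-supp⁺ m (representation-full U x)
  W : Bip _
  W = fromBlocks cs o full

-- Strict monotonicity of the rank.

no-room : ∀ i j {k} → k ≡ i ℤ.+ 1ℤ → i ℤ.+ 1ℤ ℤ.≤ j → ¬ (j ℤ.+ 1ℤ ℤ.≤ k)
no-room i j {k} k≡i+1 i+1≤j j+1≤k = ℤ.≤⇒≯ (ℤ.≤-trans (ℤ.≤-reflexive k≡i+1) i+1≤j)
  (ℤ.suc[i]≤j⇒i<j (subst (ℤ._≤ k) (ℤ.+-comm j 1ℤ) j+1≤k))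

module _ (V : Bip n) where

  -- Pairs are coded in `Fin (n ℕ.* n)`, so that the pairs of `V` missing from `U` form a `Subset`
  -- and well-foundedness of strict inclusion gives the induction.
  Missing : Bip n → Pred.Pred (Fin (n ℕ.* n)) 0ℓ
  Missing U k = let x , y = remQuot n k in Bip._∼_ V x y × ¬ Bip._∼_ U x y

  missing? : (U : Bip n) → Pred.Decidable (Missing U)
  missing? U k = let x , y = remQuot n k in Bip._∼?_ V x y ×-dec ¬? (Bip._∼?_ U x y)

  missing : Bip n → Subset (n ℕ.* n)
  missing U = comprehension (missing? U)

  missing-⊂ : {U W : Bip n} → U < W → W ≤ V → missing W ⊂ missing U
  missing-⊂ {U} {W} U<W@(U≤W , _) W≤V with x , y , xWy , ¬xUy ← <⇒difference {U = U} {W} U<W =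
      (λ k∈ → let p , q = ∈-comprehension⁻ {P = Missing W} (missing? W) k∈ in
        ∈-comprehension⁺ {P = Missing U} (missing? U) (p , q ∘ U≤W))
    , combine x y
    , ∈-comprehension⁺ {P = Missing U} (missing? U)
        (subst (λ (u , v) → Bip._∼_ V u v × ¬ Bip._∼_ U u v)
          (sym (Fin.remQuot-combine x y)) (W≤V xWy , ¬xUy))
    , λ k∈ → proj₂ (∈-comprehension⁻ {P = Missing W} (missing? W) k∈)
        (subst (λ (u , v) → Bip._∼_ W u v) (sym (Fin.remQuot-combine x y)) xWy)

  -- One move leads from `U` to some `W` inside `V` and accounts for the increase by 1. Either `W`
  -- is equivalent to `V`, or the induction continues from `W`, which misses strictly fewer pairs.
  rk-mono : (U : Bip n) → U < V → rk U ℤ.+ 1ℤ ℤ.≤ rk V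
  rk-mono U = go U (⊂-wellFounded (missing U))
    where
    go : ∀ U → Acc _⊂_ (missing U) → U < V → rk U ℤ.+ 1ℤ ℤ.≤ rk V
    go U (acc rs) U<V =
      let W , m , W≤V = <⇒Move U V U<V in
      ℤ.≤-trans (ℤ.≤-reflexive (sym (Move⇒rank U W m)))
        ([ (λ W<V → ℤ.≤-trans (ℤ.i≤i+j (rk W) 1ℤ)
                      (go W (rs (missing-⊂ {U} {W} (Move⇒< U W m) W≤V)) W<V))
         , (λ W≈V → ℤ.≤-reflexive (rk-cong {U = W} {V} W≈V))
         ]′ (≤⇒<⊎≈ {U = W} {V} W≤V))

-- Covers and moves coincide.

Move⇒Covers : (U V : Bip n) → Move (representation U) (representation V) →
              Covers (Bip-poset n) U V
Move⇒Covers U V m = Move⇒< U V m , λ W (U<W , W<V) →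
  no-room (rk U) (rk W) (Move⇒rank U V m) (rk-mono W U U<W) (rk-mono V W W<V)

Covers⇒Move : (U V : Bip n) → Covers (Bip-poset n) U V →
              Move (representation U) (representation V)
Covers⇒Move U V (U<V , between) =
  let W , m , W≤V = <⇒Move U V U<V in
  [ (λ W<V → contradiction (Move⇒< U W m , W<V) (between W))
  , (λ W≈V → subst (Move (representation U)) (representation-cong {U = W} {V} W≈V) m)
  ]′ (≤⇒<⊎≈ {U = W} {V} W≤V)

-- Maximal chains in a bounded poset with a rank function.

module _ {c ℓ₁ ℓ₂ : Level} (P : Poset c ℓ₁ ℓ₂) {ρ : Poset.Carrier P → ℤ}
         (isRank : IsRankFunction P ρ) where
  private module P = Poset P
  open P using (Carrier; module Eq)
  open PosetProperties P using () renaming (_<_ to _⊏_; <-trans to ⊏-trans)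
  open IsRankFunction isRank

  -- Consecutive members are covers, each raising `ρ` by 1, and the last member is the top.
  -- Saturation is required only above `x`, a condition that passes to the tail of the chain.
  chain-rank : {t : Carrier} → (∀ x → x P.≤ t) → ∀ x xs → AllPairs _⊏_ (x ∷ xs) →
    (∀ z → x P.≤ z → All (λ w → w P.≤ z ⊎ z P.≤ w) (x ∷ xs) → Any (z P.≈_) (x ∷ xs)) →
    ρ t ≡ ρ x ℤ.+ + length xs
  chain-rank {t} max x [] _ saturated with here t≈x ← saturated t (max x) (inj₁ (max x) ∷ []) =
    trans (ρ-cong t≈x) (sym (ℤ.+-identityʳ (ρ x)))
  chain-rank {t} max x (y ∷ ys) ((x<y ∷ x<ys) ∷ y<ys ∷ ps) saturated = begin
    ρ t                                ≡⟨ chain-rank max y ys (y<ys ∷ ps) saturated′ ⟩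
    ρ y ℤ.+ + length ys                ≡⟨ cong (ℤ._+ + length ys) (ρ-covers (x<y , between)) ⟩
    ρ x ℤ.+ 1ℤ ℤ.+ + length ys         ≡⟨ ℤ.+-assoc (ρ x) 1ℤ (+ length ys) ⟩
    ρ x ℤ.+ + suc (length ys)          ∎
    where
    open ≡-Reasoning

    saturated′ : ∀ z → y P.≤ z → All (λ w → w P.≤ z ⊎ z P.≤ w) (y ∷ ys) → Any (z P.≈_) (y ∷ ys)
    saturated′ z y≤z comparable
      with saturated z (P.trans (proj₁ x<y) y≤z) (inj₁ (P.trans (proj₁ x<y) y≤z) ∷ comparable)
    ... | there z∈ = z∈
    ... | here z≈x = contradiction
      (P.antisym (proj₁ x<y) (P.trans y≤z (P.reflexive z≈x))) (proj₂ x<y)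

    between : ∀ z → ¬ (x ⊏ z × z ⊏ y)
    between z (x<z , z<y)
      with saturated z (proj₁ x<z) (inj₁ (proj₁ x<z) ∷ inj₂ (proj₁ z<y) ∷
             All.map (λ y<w → inj₂ (P.trans (proj₁ z<y) (proj₁ y<w))) y<ys)
    ... | here z≈x         = proj₂ x<z (Eq.sym z≈x)
    ... | there (here z≈y) = proj₂ z<y z≈y
    -- A member of `ys` lies above `y`, so `z` would be both above and strictly below `y`.
    ... | there (there z∈) = All.lookupWith
      (λ y<w z≈w → proj₂ z<y (P.antisym (proj₁ z<y) (P.trans (proj₁ y<w) (P.reflexive (Eq.sym z≈w)))))
      y<ys z∈

  -- The bottom is comparable with everything and so belongs to the chain. The first member is
  -- therefore minimal, has rank 0, and the length is one more than the rank of the top.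
  length-maximal : {b t : Carrier} → (∀ x → b P.≤ x) → (∀ x → x P.≤ t) →
    ∀ xs → MaximalChain P xs → + length xs ≡ 1ℤ ℤ.+ ρ t
  -- The empty chain is not maximal, as `b` is vacuously comparable with all its members.
  length-maximal {b} min max [] c = contradiction (MaximalChain.maximal c b []) λ ()
  length-maximal {b} {t} min max (x ∷ xs) c = cong (λ k → 1ℤ ℤ.+ k) (sym (begin
    ρ t                   ≡⟨ chain-rank max x xs (x<xs ∷ ps) (λ z _ → maximal z) ⟩
    ρ x ℤ.+ + length xs   ≡⟨ cong (ℤ._+ + length xs) (ρ-minimal minimal) ⟩
    0ℤ ℤ.+ + length xs    ≡⟨ ℤ.+-identityˡ (+ length xs) ⟩
    + length xs           ∎))
    where
    open ≡-Reasoning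
    open MaximalChain c
    increasing = Linked⇒AllPairs ⊏-trans chain
    x<xs = AllPairs.head increasing
    ps   = AllPairs.tail increasing

    x≤b : x P.≤ b
    x≤b with maximal b (All.universal (λ w → inj₂ (min w)) (x ∷ xs))
    ... | here b≈x = P.reflexive (Eq.sym b≈x)
    ... | there b∈ = All.lookupWith
      (λ x<w b≈w → P.trans (proj₁ x<w) (P.reflexive (Eq.sym b≈w))) x<xs b∈

    minimal : Minimal P x
    minimal y y≤x = P.antisym y≤x (P.trans x≤b (min y))

  graded : {b t : Carrier} → (∀ x → b P.≤ x) → (∀ x → x P.≤ t) → Graded P
  graded min max xs ys c d = ℤ.+-injective
    (trans (length-maximal min max xs c) (sym (length-maximal min max ys d)))

-- The least and greatest relations, and the theorem.

∅ᴮ : Bip n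
∅ᴮ = record
  { _∼_ = λ _ _ → ⊥
  ; _∼?_ = λ _ _ → no λ ()
  ; ∼-trans = λ ()
  ; ≁-trans = λ _ _ ()
  }

⊤ᴮ : Bip n
⊤ᴮ = record
  { _∼_ = λ _ _ → Unit
  ; _∼?_ = λ _ _ → yes tt
  ; ∼-trans = λ _ _ → tt
  ; ≁-trans = λ ¬tt _ → ¬tt
  }

-- A minimal relation is empty, and its representation is the whole nonempty set as one
-- nonunderlined block, of rank 1 - 1 = 0.
rk-minimal : .{{_ : NonZero n}} (U : Bip n) → Minimal (Bip-poset n) U → rk U ≡ 0ℤ
rk-minimal {n = suc _} U minimal = cong blocksRank (representation-unique U {bs = (⊤ ^ false) ∷ []}
  (cons (Fin.zero , ∈⊤) (λ _ ()) []) (λ _ → here ∈⊤)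
  (λ where (within _ _ ())) (λ xy → ⊥-elim (proj₂ (minimal ∅ᴮ λ ()) xy)))

rk-isRankFunction : ∀ n .{{_ : NonZero n}} → IsRankFunction (Bip-poset n) rk
rk-isRankFunction n = record
  { ρ-cong    = λ {U} {V} → rk-cong {U = U} {V}
  ; ρ-minimal = λ {U} → rk-minimal U
  ; ρ-covers  = λ {U} {V} U⋖V → Move⇒rank U V (Covers⇒Move U V U⋖V)
  }

theorem5p1 : (n : ℕ) .{{_ : NonZero n}} →
    ((U V : Bip n) →
    Covers (Bip-poset n) U V ⇔ Move (representation U) (representation V))
    × Graded (Bip-poset n)
    × IsRankFunction (Bip-poset n) rk
theorem5p1 n =
    (λ U V → mk⇔ (Covers⇒Move U V) (Move⇒Covers U V))
  , graded (Bip-poset n) (rk-isRankFunction n) {∅ᴮ} {⊤ᴮ} (λ _ ()) (λ _ _ → tt)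
  , rk-isRankFunction n
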